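{- Let $V$ be a finite set with $n=|V|$ and let $\mathcal{P}=(P_t)_{t\ge1}$ be a sequence of transition matrices on $V$ (not necessarily having a time-homogeneous stationary distribution). Consider the pull voting according to $\mathcal{P}$ in which initially all vertices have $n$ distinct opinions. Then there is a sequence $(\mathcal{Q}^{(i)})_{i\ge0}$, where each $\mathcal{Q}^{(i)}=(Q^{(i)}_t)_{t\ge1}$ is a sequence of transition matrices on $V$, such that for every integer $j\ge0$, $$\Pr[\tau_{\mathrm{cons}}(\mathcal{P})\le j]=\Pr[\tau_{\mathrm{coal}}(\mathcal{Q}^{(j)})\le j].$$ Moreover, if $\mathcal{P}$ is reversible and has the time-invariant stationary distribution $\pi$ (i.e. every $P_t$ is reversible with stationary distribution $\pi$), then so do the sequences $\mathcal{Q}^{(i)}$ for all $i$.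
   Context: A transition matrix on $V$ is a row-stochastic matrix in $[0,1]^{V\times V}$. It is reversible with respect to $\pi$ if $\pi(u)P(u,v)=\pi(v)P(v,u)$ for all $u,v$. Pull voting according to $\mathcal{P}$: each vertex holds an opinion. At round $t\ge1$, simultaneously and independently, each vertex $u$ picks a vertex $v$ according to $P_t(u,\cdot)$ and replaces its opinion by the opinion that $v$ held at the beginning of the round. $\tau_{\mathrm{cons}}(\mathcal{P})$ is the first time $t\ge0$ at which all vertices hold the same opinion. Coalescing random walk according to $\mathcal{Q}=(Q_t)_{t\ge1}$: initially there is exactly one walker on each vertex of $V$. At step $t\ge1$, all walkers located at the same vertex $u$ move together to one vertex sampled from $Q_t(u,\cdot)$, independently for distinct $u$. $\tau_{\mathrm{coal}}(\mathcal{Q})$ is the first time $t\ge0$ at which all walkers are at a single vertex. -}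

module Defs where

open import Algebra.Bundles using (CommutativeRing)
import Algebra.Properties.CommutativeMonoid.Sum as Sum
open import Data.Bool.Base using (if_then_else_)
open import Data.Fin.Base using (Fin; zero; suc; toℕ; finToFun) renaming (_<_ to _<ᶠ_)
open import Data.Fin.Properties using (all?; any?; inj⇒≟) renaming (_<?_ to _<ᶠ?_)
open import Data.Nat.Base as ℕ using (ℕ; zero; suc; _^_; _⊔_)
import Data.Nat.Properties as ℕ
open import Data.Product.Base using (∃-syntax; _×_; _,_)
open import Data.Rational.Base as ℚ using (ℚ; 0ℚ; 1ℚ; ½; Positive; positive; ∣_∣)
import Data.Rational.Properties as ℚ
open import Data.Rational.Solver using (module +-*-Solver)
open import Data.Vec.Functional using (Vector; tail)
open import Function.Base using (_∘_; id)
open import Function.Bundles using (_↔_; Inverse)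
open import Function.Properties.Inverse using (Inverse⇒Injection)
open import Level using (0ℓ)
open import Relation.Binary.Definitions using (DecidableEquality)
open import Relation.Binary.PropositionalEquality
open import Relation.Nullary.Decidable using (Dec; does; map′; ¬?; _×-dec_; _→-dec_)
open import Relation.Nullary.Negation using (¬_)

------------------------------------------------------------------------
-- Real numbers: Cauchy sequences of rationals, with setoid equality.

-- x m - y n tends to 0 as m and n tend to infinity independently.  With x = y
-- this says that x is Cauchy; between Cauchy sequences it is the usual
-- "same limit" relation.
record Close (x y : ℕ → ℚ) : Set where
  constructor mkClose
  field
    within : ∀ ε → 0ℚ ℚ.< ε →
      ∃[ N ] (∀ m n → N ℕ.≤ m → N ℕ.≤ n → ∣ x m ℚ.- y n ∣ ℚ.< ε)

open Close

record ℝ : Set where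
  constructor mkℝ
  field
    seq    : ℕ → ℚ
    cauchy : Close seq seq

open ℝ public

infix 4 _≈_ _≤_

record _≈_ (x y : ℝ) : Set where
  constructor mk≈
  field close : Close (seq x) (seq y)

open _≈_ public

record _≤_ (x y : ℝ) : Set where
  constructor mk≤
  field
    below : ∀ ε → 0ℚ ℚ.< ε → ∃[ N ] (∀ n → N ℕ.≤ n → seq x n ℚ.< seq y n ℚ.+ ε)

private
  module _ where
    open +-*-Solver

    split-trans : ∀ x y z → x ℚ.- z ≡ (x ℚ.- y) ℚ.+ (y ℚ.- z)
    split-trans = solve 3 (λ x y z → x :- z := (x :- y) :+ (y :- z)) refl

    split-bound : ∀ x y → x ≡ (x ℚ.- y) ℚ.+ y
    split-bound = solve 2 (λ x y → x := (x :- y) :+ y) refl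

    split-+ : ∀ x y x′ y′ →
      (x ℚ.+ y) ℚ.- (x′ ℚ.+ y′) ≡ (x ℚ.- x′) ℚ.+ (y ℚ.- y′)
    split-+ = solve 4
      (λ x y x′ y′ → (x :+ y) :- (x′ :+ y′) := (x :- x′) :+ (y :- y′)) refl

    split-* : ∀ x y x′ y′ →
      (x ℚ.* y) ℚ.- (x′ ℚ.* y′) ≡ x ℚ.* (y ℚ.- y′) ℚ.+ y′ ℚ.* (x ℚ.- x′)
    split-* = solve 4
      (λ x y x′ y′ →
        (x :* y) :- (x′ :* y′) := x :* (y :- y′) :+ y′ :* (x :- x′)) refl

    swap-neg : ∀ x y → x ℚ.- y ≡ ℚ.- (y ℚ.- x)
    swap-neg = solve 2 (λ x y → x :- y := :- (y :- x)) refl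

    neg-neg : ∀ x y → (ℚ.- x) ℚ.- (ℚ.- y) ≡ ℚ.- (x ℚ.- y)
    neg-neg = solve 2 (λ x y → (:- x) :- (:- y) := :- (x :- y)) refl

    two-halves : ∀ x → ½ ℚ.* x ℚ.+ ½ ℚ.* x ≡ x
    two-halves x = trans (sym (ℚ.*-distribʳ-+ x ½ ½)) (ℚ.*-identityˡ x)

  abstract
    ½-pos : ∀ {ε} → 0ℚ ℚ.< ε → 0ℚ ℚ.< ½ ℚ.* ε
    ½-pos {ε} 0<ε = ℚ.positive⁻¹ _ {{ℚ.pos*pos⇒pos ½ ε {{positive 0<ε}}}}

    ∣-∣-sym : ∀ x y → ∣ x ℚ.- y ∣ ≡ ∣ y ℚ.- x ∣
    ∣-∣-sym x y = trans (cong ∣_∣ (swap-neg x y)) (ℚ.∣-p∣≡∣p∣ (y ℚ.- x))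

    sum-small : ∀ {a b ε} → ∣ a ∣ ℚ.< ½ ℚ.* ε → ∣ b ∣ ℚ.< ½ ℚ.* ε → ∣ a ℚ.+ b ∣ ℚ.< ε
    sum-small {a} {b} {ε} a< b< = subst (∣ a ℚ.+ b ∣ ℚ.<_) (two-halves ε)
      (ℚ.≤-<-trans (ℚ.∣p+q∣≤∣p∣+∣q∣ a b) (ℚ.+-mono-< a< b<))

    Close-sym : ∀ {x y} → Close x y → Close y x
    Close-sym {x} {y} p = mkClose λ ε 0<ε → let (N , h) = within p ε 0<ε in N , λ m n N≤m N≤n →
      subst (ℚ._< ε) (∣-∣-sym (x n) (y m)) (h n m N≤n N≤m)

    Close-trans : ∀ {x y z} → Close x y → Close y z → Close x z
    Close-trans {x} {y} {z} p q = mkClose λ ε 0<ε →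
      let (N , h) = within p (½ ℚ.* ε) (½-pos 0<ε)
          (M , k) = within q (½ ℚ.* ε) (½-pos 0<ε)
      in N ⊔ M , λ m n ≤m ≤n →
      subst (λ d → ∣ d ∣ ℚ.< ε) (sym (split-trans (x m) (y (N ⊔ M)) (z n)))
        (sum-small {x m ℚ.- y (N ⊔ M)} {y (N ⊔ M) ℚ.- z n}
          (h m (N ⊔ M) (ℕ.m⊔n≤o⇒m≤o N M ≤m) (ℕ.m≤m⊔n N M))
          (k (N ⊔ M) n (ℕ.m≤n⊔m N M) (ℕ.m⊔n≤o⇒n≤o N M ≤n)))

    Close-+ : ∀ {x x′ y y′} → Close x x′ → Close y y′ →
      Close (λ n → x n ℚ.+ y n) (λ n → x′ n ℚ.+ y′ n)
    Close-+ {x} {x′} {y} {y′} p q = mkClose λ ε 0<ε →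
      let (N , h) = within p (½ ℚ.* ε) (½-pos 0<ε)
          (M , k) = within q (½ ℚ.* ε) (½-pos 0<ε)
      in N ⊔ M , λ m n ≤m ≤n →
      subst (λ d → ∣ d ∣ ℚ.< ε) (sym (split-+ (x m) (y m) (x′ n) (y′ n)))
        (sum-small {x m ℚ.- x′ n} {y m ℚ.- y′ n}
          (h m n (ℕ.m⊔n≤o⇒m≤o N M ≤m) (ℕ.m⊔n≤o⇒m≤o N M ≤n))
          (k m n (ℕ.m⊔n≤o⇒n≤o N M ≤m) (ℕ.m⊔n≤o⇒n≤o N M ≤n)))

    Close-neg : ∀ {x x′} → Close x x′ → Close (ℚ.-_ ∘ x) (ℚ.-_ ∘ x′)
    Close-neg {x} {x′} p = mkClose λ ε 0<ε → let (N , h) = within p ε 0<ε in N , λ m n ≤m ≤n →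
      subst (ℚ._< ε)
        (sym (trans (cong ∣_∣ (neg-neg (x m) (x′ n))) (ℚ.∣-p∣≡∣p∣ (x m ℚ.- x′ n))))
        (h m n ≤m ≤n)

    bounded : ∀ {x x′} → Close x x′ →
      ∃[ B ] (0ℚ ℚ.< B × ∃[ N ] (∀ m → N ℕ.≤ m → ∣ x m ∣ ℚ.≤ B))
    bounded {x} {x′} p with within p 1ℚ (ℚ.positive⁻¹ 1ℚ)
    ... | N , h =
      1ℚ ℚ.+ ∣ x′ N ∣ ,
      ℚ.+-mono-<-≤ {0ℚ} {1ℚ} (ℚ.positive⁻¹ 1ℚ) (ℚ.0≤∣p∣ (x′ N)) ,
      N , λ m ≤m → subst (λ d → ∣ d ∣ ℚ.≤ 1ℚ ℚ.+ ∣ x′ N ∣)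
        (sym (split-bound (x m) (x′ N)))
        (ℚ.≤-trans (ℚ.∣p+q∣≤∣p∣+∣q∣ (x m ℚ.- x′ N) (x′ N))
          (ℚ.+-monoˡ-≤ ∣ x′ N ∣ (ℚ.<⇒≤ (h m N ≤m ℕ.≤-refl))))

    divide : ∀ B ε → 0ℚ ℚ.< B → 0ℚ ℚ.< ε → ∃[ δ ] (0ℚ ℚ.< δ × B ℚ.* δ ≡ ε)
    divide B ε 0<B 0<ε =
      let pos = positive 0<B
          B≢0 = ℚ.pos⇒nonZero B {{pos}}
          B⁻¹ = (ℚ.1/ B) {{B≢0}}
      in B⁻¹ ℚ.* ε ,
         ℚ.positive⁻¹ (B⁻¹ ℚ.* ε)
           {{ℚ.pos*pos⇒pos B⁻¹ {{ℚ.1/pos⇒pos B {{pos}}}} ε {{positive 0<ε}}}} ,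
         trans (sym (ℚ.*-assoc B B⁻¹ ε))
           (trans (cong (ℚ._* ε) (ℚ.*-inverseʳ B {{B≢0}})) (ℚ.*-identityˡ ε))

    prod-small : ∀ {a b B δ η} → 0ℚ ℚ.< B → B ℚ.* δ ≡ η →
      ∣ a ∣ ℚ.≤ B → ∣ b ∣ ℚ.< δ → ∣ a ℚ.* b ∣ ℚ.< η
    prod-small {a} {b} {B} {δ} 0<B refl a≤ b< =
      subst (ℚ._< B ℚ.* δ) (sym (ℚ.∣p*q∣≡∣p∣*∣q∣ a b))
        (ℚ.≤-<-trans
          (ℚ.*-monoʳ-≤-nonNeg ∣ b ∣ {{ℚ.nonNegative (ℚ.0≤∣p∣ b)}} a≤)
          (ℚ.*-monoʳ-<-pos B {{positive 0<B}} b<))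

    *-small : ∀ x y x′ y′ {A α B β ε} →
      0ℚ ℚ.< A → A ℚ.* α ≡ ½ ℚ.* ε → 0ℚ ℚ.< B → B ℚ.* β ≡ ½ ℚ.* ε →
      ∣ x ∣ ℚ.≤ A → ∣ y ℚ.- y′ ∣ ℚ.< α → ∣ y′ ∣ ℚ.≤ B → ∣ x ℚ.- x′ ∣ ℚ.< β →
      ∣ (x ℚ.* y) ℚ.- (x′ ℚ.* y′) ∣ ℚ.< ε
    *-small x y x′ y′ {ε = ε} 0<A Aα 0<B Bβ x≤A dy< y′≤B dx< =
      subst (λ d → ∣ d ∣ ℚ.< ε) (sym (split-* x y x′ y′))
        (sum-small {x ℚ.* (y ℚ.- y′)} {y′ ℚ.* (x ℚ.- x′)}
          (prod-small {x} {y ℚ.- y′} 0<A Aα x≤A dy<)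
          (prod-small {y′} {x ℚ.- x′} 0<B Bβ y′≤B dx<))

    Close-* : ∀ {x x′ y y′} → Close x x′ → Close y y′ →
      Close (λ n → x n ℚ.* y n) (λ n → x′ n ℚ.* y′ n)
    Close-* {x} {x′} {y} {y′} p q = mkClose λ ε 0<ε →
      let (A , 0<A , K , x≤A)  = bounded p
          (B , 0<B , L , y′≤B) = bounded (Close-sym q)
          (α , 0<α , Aα)       = divide A (½ ℚ.* ε) 0<A (½-pos 0<ε)
          (β , 0<β , Bβ)       = divide B (½ ℚ.* ε) 0<B (½-pos 0<ε)
          (M , k)              = within q α 0<α
          (N , h)              = within p β 0<β
          ≤K : ∀ {i} → (K ⊔ L) ⊔ (M ⊔ N) ℕ.≤ i → K ℕ.≤ i
          ≤K = ℕ.m⊔n≤o⇒m≤o K L ∘ ℕ.m⊔n≤o⇒m≤o (K ⊔ L) (M ⊔ N)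
          ≤L : ∀ {i} → (K ⊔ L) ⊔ (M ⊔ N) ℕ.≤ i → L ℕ.≤ i
          ≤L = ℕ.m⊔n≤o⇒n≤o K L ∘ ℕ.m⊔n≤o⇒m≤o (K ⊔ L) (M ⊔ N)
          ≤M : ∀ {i} → (K ⊔ L) ⊔ (M ⊔ N) ℕ.≤ i → M ℕ.≤ i
          ≤M = ℕ.m⊔n≤o⇒m≤o M N ∘ ℕ.m⊔n≤o⇒n≤o (K ⊔ L) (M ⊔ N)
          ≤N : ∀ {i} → (K ⊔ L) ⊔ (M ⊔ N) ℕ.≤ i → N ℕ.≤ i
          ≤N = ℕ.m⊔n≤o⇒n≤o M N ∘ ℕ.m⊔n≤o⇒n≤o (K ⊔ L) (M ⊔ N)
      in (K ⊔ L) ⊔ (M ⊔ N) , λ m n ≤m ≤n →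
        *-small (x m) (y m) (x′ n) (y′ n) 0<A Aα 0<B Bβ
          (x≤A m (≤K ≤m)) (k m n (≤M ≤m) (≤M ≤n))
          (y′≤B n (≤L ≤n)) (h m n (≤N ≤m) (≤N ≤n))

    Close-const : ∀ q → Close (λ _ → q) (λ _ → q)
    Close-const q = mkClose λ ε 0<ε → 0 , λ _ _ _ _ →
      subst (λ d → ∣ d ∣ ℚ.< ε) (sym (ℚ.+-inverseʳ q)) 0<ε

    pointwise : ∀ {x y} → (∀ n → seq x n ≡ seq y n) → x ≈ y
    pointwise {x} {y} e = mk≈ (mkClose λ ε 0<ε → let (N , h) = within (cauchy x) ε 0<ε in
      N , λ m n ≤m ≤n → subst (λ d → ∣ seq x m ℚ.- d ∣ ℚ.< ε) (e n) (h m n ≤m ≤n))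

infixl 6 _+_
infixl 7 _*_
infix  8 -_

fromℚ : ℚ → ℝ
fromℚ q = mkℝ (λ _ → q) (Close-const q)

0ℝ 1ℝ : ℝ
0ℝ = fromℚ 0ℚ
1ℝ = fromℚ 1ℚ

_+_ _*_ : ℝ → ℝ → ℝ
x + y = mkℝ (λ n → seq x n ℚ.+ seq y n) (Close-+ (cauchy x) (cauchy y))
x * y = mkℝ (λ n → seq x n ℚ.* seq y n) (Close-* (cauchy x) (cauchy y))

-_ : ℝ → ℝ
- x = mkℝ (λ n → ℚ.- seq x n) (Close-neg (cauchy x))

ℝ-commutativeRing : CommutativeRing 0ℓ 0ℓ
ℝ-commutativeRing = record
  { Carrier = ℝ ; _≈_ = _≈_ ; _+_ = _+_ ; _*_ = _*_ ; -_ = -_ ; 0# = 0ℝ ; 1# = 1ℝ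
  ; isCommutativeRing = record
    { isRing = record
      { +-isAbelianGroup = record
        { isGroup = record
          { isMonoid = record
            { isSemigroup = record
              { isMagma = record
                { isEquivalence = record
                  { refl  = λ {x} → mk≈ (cauchy x)
                  ; sym   = λ p → mk≈ (Close-sym (close p))
                  ; trans = λ p q → mk≈ (Close-trans (close p) (close q))
                  }
                ; ∙-cong = λ p q → mk≈ (Close-+ (close p) (close q))
                }
              ; assoc = λ x y z → pointwise λ n → ℚ.+-assoc (seq x n) (seq y n) (seq z n)
              }
            ; identity = (λ x → pointwise λ n → ℚ.+-identityˡ (seq x n))
                       , (λ x → pointwise λ n → ℚ.+-identityʳ (seq x n))
            }
          ; inverse = (λ x → pointwise λ n → ℚ.+-inverseˡ (seq x n))
                    , (λ x → pointwise λ n → ℚ.+-inverseʳ (seq x n))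
          ; ⁻¹-cong = λ p → mk≈ (Close-neg (close p))
          }
        ; comm = λ x y → pointwise λ n → ℚ.+-comm (seq x n) (seq y n)
        }
      ; *-cong = λ p q → mk≈ (Close-* (close p) (close q))
      ; *-assoc = λ x y z → pointwise λ n → ℚ.*-assoc (seq x n) (seq y n) (seq z n)
      ; *-identity = (λ x → pointwise λ n → ℚ.*-identityˡ (seq x n))
                   , (λ x → pointwise λ n → ℚ.*-identityʳ (seq x n))
      ; distrib = (λ x y z → pointwise λ n → ℚ.*-distribˡ-+ (seq x n) (seq y n) (seq z n))
                , (λ x y z → pointwise λ n → ℚ.*-distribʳ-+ (seq x n) (seq y n) (seq z n))
      }
    ; *-comm = λ x y → pointwise λ n → ℚ.*-comm (seq x n) (seq y n)
    }
  }

open CommutativeRing ℝ-commutativeRing public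
  using (+-commutativeMonoid; *-commutativeMonoid)

open Sum +-commutativeMonoid public using (sum)
open Sum *-commutativeMonoid public using () renaming (sum to product)

------------------------------------------------------------------------

Matrix : Set → Set
Matrix V = V → V → ℝ

module _ {n : ℕ} {V : Set} (enum : V ↔ Fin n) where

  open Inverse enum using (to; from; strictlyInverseʳ)

  ∑ ∏ : (V → ℝ) → ℝ
  ∑ f = sum (f ∘ from)
  ∏ f = product (f ∘ from)

  record IsTransition (P : Matrix V) : Set where
    field
      nonNeg     : ∀ u v → 0ℝ ≤ P u v
      ≤1         : ∀ u v → P u v ≤ 1ℝ
      stochastic : ∀ u → ∑ (λ v → P u v) ≈ 1ℝ

  record IsDistribution (π : V → ℝ) : Set where
    field
      nonNeg : ∀ v → 0ℝ ≤ π v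
      total  : ∑ π ≈ 1ℝ

  record IsReversibleStationary (π : V → ℝ) (P : Matrix V) : Set where
    field
      distribution : IsDistribution π
      stationary   : ∀ v → ∑ (λ u → π u * P u v) ≈ π v
      reversible   : ∀ u v → π u * P u v ≈ π v * P v u

------------------------------------------------------------------------
-- The randomness of j rounds: for each round, a choice of a vertex by
-- every vertex.

  Round : Set
  Round = V → V

  -- finToFun enumerates all functions between finite types, so that
  -- outcome enumerates all j-tuples of rounds without repetition.
  outcome : ∀ {j} → Fin ((n ^ n) ^ j) → Vector Round j
  outcome k t u = from (finToFun (finToFun k t) (to u))

  -- Vertices choose independently, u with law P t u, and rounds are
  -- independent.  Sequences are indexed from 0: P t governs round t + 1.
  weight : (ℕ → Matrix V) → ∀ {j} → Vector Round j → ℝ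
  weight P ω = product (λ t → ∏ (λ u → P (toℕ t) u (ω t u)))

  -- The event E depends on the first j rounds only.
  Pr : (ℕ → Matrix V) → (j : ℕ) {E : Vector Round j → Set} → (∀ ω → Dec (E ω)) → ℝ
  Pr P j E? = sum {(n ^ n) ^ j} λ k →
    if does (E? (outcome {j} k)) then weight P (outcome {j} k) else 0ℝ

------------------------------------------------------------------------

  -- The state at time i, for i = 0, …, j, where round i + 1 leads from
  -- the state at time i to the state at time i + 1.
  run : {S : Set} → (Round → S → S) → S → ∀ {j} → Vector Round j → Fin (suc j) → S
  run step x         ω zero    = x
  run step x {suc j} ω (suc i) = run step (step (ω zero) x) (tail ω) i

  IsFirst : ∀ {m} → (Fin m → Set) → Fin m → Set
  IsFirst A i = A i × (∀ k → k <ᶠ i → ¬ A k)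

  -- For the opinion map this is consensus; for the map from walkers to
  -- positions it says that all walkers are at a single vertex.
  Constant : {A : Set} → (V → A) → Set
  Constant x = ∀ u v → x u ≡ x v

  -- The event "τ ≤ j" for τ the first time at which x is constant; it is
  -- determined by the states at times 0, …, j.
  FirstConstant≤ : {A : Set} (j : ℕ) → (Fin (suc j) → V → A) → Set
  FirstConstant≤ j x = ∃[ τ ] IsFirst (λ i → Constant (x i)) τ

  all-V? : {A : V → Set} → (∀ v → Dec (A v)) → Dec (∀ v → A v)
  all-V? {A} A? = map′ (λ h v → subst A (strictlyInverseʳ v) (h (to v)))
                       (λ h i → h (from i)) (all? (λ i → A? (from i)))

  constant? : {A : Set} → DecidableEquality A → (x : V → A) → Dec (Constant x)
  constant? _≟_ x = all-V? λ u → all-V? λ v → x u ≟ x v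

  firstConstant≤? : {A : Set} → DecidableEquality A →
    ∀ j (x : Fin (suc j) → V → A) → Dec (FirstConstant≤ j x)
  firstConstant≤? _≟_ j x = any? λ τ → constant? _≟_ (x τ) ×-dec
    all? (λ k → (k <ᶠ? τ) →-dec ¬? (constant? _≟_ (x k)))

------------------------------------------------------------------------
-- Pull voting: the state is the opinion of every vertex.

  pullStep : {O : Set} → Round → (V → O) → (V → O)
  pullStep f x u = x (f u)

  opinions : {O : Set} → (V → O) → ∀ {j} → Vector Round j → Fin (suc j) → V → O
  opinions = run pullStep

  Pr[τcons_⟨_,_⟩≤_] : (ℕ → Matrix V) → {O : Set} → DecidableEquality O → (V → O) → ℕ → ℝ
  Pr[τcons P ⟨ _≟_ , ξ ⟩≤ j ] = Pr P j (λ ω → firstConstant≤? _≟_ j (opinions ξ ω))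

------------------------------------------------------------------------
-- Coalescing random walk: the state is the position of every walker,
-- walkers being named by their initial vertices.  A vertex moves all of
-- its walkers to its chosen vertex; choices of unoccupied vertices have
-- no effect.

  walkStep : Round → (V → V) → (V → V)
  walkStep f x w = f (x w)

  positions : ∀ {j} → Vector Round j → Fin (suc j) → V → V
  positions = run walkStep id

  Pr[τcoal_≤_] : (ℕ → Matrix V) → ℕ → ℝ
  Pr[τcoal Q ≤ j ] =
    Pr Q j (λ ω → firstConstant≤? (inj⇒≟ (Inverse⇒Injection enum)) j (positions ω))

{-# OPTIONS --safe #-}

-- After j rounds with choices ω₁, …, ωⱼ the opinion of u is ξ (ω₁ (… (ωⱼ u))),
-- whereas the walker named u sits at ωⱼ (… (ω₁ u)).  Reversing the order of the
-- first j rounds therefore turns consensus into coalescence.  Since consensus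
-- and coalescence persist, both hitting times are at most j exactly when the
-- state at time j is constant.

module Submission where

open import Defs
open import Algebra.Bundles using (CommutativeRing)
import Algebra.Properties.CommutativeMonoid.Sum as Sum
open import Data.Bool.Base using (if_then_else_; true; false)
open import Data.Fin.Base
  using (Fin; zero; suc; toℕ; fromℕ; inject₁; opposite; finToFun; funToFin; combine)
  renaming (_<_ to _<ᶠ_)
open import Data.Fin.Permutation using (Permutation; permutation; reverse)
open import Data.Fin.Properties
  using (inj⇒≟; finToFun-funToFin; funToFin-finToFin; opposite-involutive; opposite-prop)
open import Data.Nat.Base using (ℕ; zero; suc; _∸_; _^_; s<s⁻¹)
open import Data.Product.Base using (Σ-syntax; _×_; _,_)
open import Data.Vec.Functional using (Vector; tail)
open import Function.Base using (_∘_; id)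
open import Function.Bundles using (_↔_; _⇔_; mk⇔; Inverse)
open import Function.Definitions using (Injective)
open import Function.Properties.Equivalence using () renaming (trans to ⇔-trans; sym to ⇔-sym)
open import Function.Properties.Inverse using (Inverse⇒Injection)
open import Relation.Binary.Definitions using (DecidableEquality)
open import Relation.Binary.PropositionalEquality
  using (_≡_; _≗_; refl; sym; trans; cong; cong₂; subst₂; module ≡-Reasoning)
import Relation.Binary.Reasoning.Setoid as SetoidReasoning
open import Relation.Nullary.Decidable using (Dec; yes; no; does; does-⇔)
open import Relation.Nullary.Negation using (¬_; contradiction)

open CommutativeRing ℝ-commutativeRing using (setoid; reflexive)

private
  module ΣR = Sum +-commutativeMonoid
  module ΠR = Sum *-commutativeMonoid

funToFin-cong : ∀ {m n} {f g : Fin m → Fin n} → f ≗ g → funToFin f ≡ funToFin g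
funToFin-cong {zero}  f≗g = refl
funToFin-cong {suc m} f≗g = cong₂ combine (f≗g zero) (funToFin-cong (f≗g ∘ suc))

-- `outcome` reads its index as a numeral with `j` digits in base `n ^ n`, one digit per round, so
-- reversing digits reverses the order of the rounds.
reverseDigits : ∀ m j → Fin (m ^ j) → Fin (m ^ j)
reverseDigits m j k = funToFin (finToFun {m} {j} k ∘ opposite)

finToFun-reverseDigits : ∀ m j (k : Fin (m ^ j)) →
  finToFun {m} {j} (reverseDigits m j k) ≗ finToFun {m} {j} k ∘ opposite
finToFun-reverseDigits m j k = finToFun-funToFin (finToFun {m} {j} k ∘ opposite)

reverseDigits-involutive : ∀ m j (k : Fin (m ^ j)) → reverseDigits m j (reverseDigits m j k) ≡ k
reverseDigits-involutive m j k = begin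
  reverseDigits m j (reverseDigits m j k)
    ≡⟨ funToFin-cong (finToFun-reverseDigits m j k ∘ opposite) ⟩
  funToFin (finToFun {m} {j} k ∘ opposite ∘ opposite)
    ≡⟨ funToFin-cong (λ i → cong (finToFun {m} {j} k) (opposite-involutive i)) ⟩
  funToFin (finToFun {m} {j} k)
    ≡⟨ funToFin-finToFin {j} {m} k ⟩
  k ∎
  where open ≡-Reasoning

digitReversal : ∀ m j → Permutation (m ^ j) (m ^ j)
digitReversal m j = permutation (reverseDigits m j) (reverseDigits m j)
  (reverseDigits-involutive m j) (reverseDigits-involutive m j)

module _ {n : ℕ} {V : Set} (enum : V ↔ Fin n) where

  open Inverse enum using (from; to)

  -- Search upwards from time 0: decidability settles each time in turn, and the given `i`
  -- guarantees that the search succeeds.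
  IsFirst-exists : ∀ {m} {A : Fin m → Set} → (∀ i → Dec (A i)) →
    ∀ i → A i → Σ[ τ ∈ Fin m ] IsFirst enum A τ
  IsFirst-exists {suc m} A? i a with A? zero
  ... | yes a₀ = zero , a₀ , λ _ ()
  IsFirst-exists {suc m} A? zero a | no ¬a₀ = contradiction a ¬a₀
  IsFirst-exists {suc m} {A} A? (suc i) a | no ¬a₀ with IsFirst-exists (A? ∘ suc) i a
  ... | τ , a′ , least = suc τ , a′ , least′
    where
    least′ : ∀ k → k <ᶠ suc τ → ¬ A k
    least′ zero    _   = ¬a₀
    least′ (suc k) k<τ = least k (s<s⁻¹ k<τ)

  module _ {A : Set} (step : Round enum → (V → A) → (V → A))
    (persists : ∀ f x → Constant enum x → Constant enum (step f x)) where

    final-Constant : ∀ {j} (ω : Vector (Round enum) j) x i →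
      Constant enum (run enum step x ω i) → Constant enum (run enum step x ω (fromℕ j))
    final-Constant {zero}  ω x zero    c = c
    final-Constant {suc j} ω x zero    c =
      final-Constant (tail ω) (step (ω zero) x) zero (persists (ω zero) x c)
    final-Constant {suc j} ω x (suc i) c = final-Constant (tail ω) (step (ω zero) x) i c

    -- Reversal does not match the intermediate states of the two processes. This reduces both
    -- hitting-time events to the final state, which depends only on the composite of all rounds.
    FirstConstant≤⇔final : DecidableEquality A → ∀ {j} (ω : Vector (Round enum) j) x →
      FirstConstant≤ enum j (run enum step x ω) ⇔ Constant enum (run enum step x ω (fromℕ j))
    FirstConstant≤⇔final _≟_ {j} ω x = mk⇔
      (λ (τ , c , _) → final-Constant ω x τ c)
      (IsFirst-exists (λ i → constant? enum _≟_ (run enum step x ω i)) (fromℕ j))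

  -- The two orders of composition. `pullPath ω u` is the vertex where the final opinion of `u`
  -- originated; `walkPath ω w` is where the walker `w` ends.
  pullPath walkPath : ∀ {j} → Vector (Round enum) j → V → V
  pullPath {zero}  ω = id
  pullPath {suc j} ω = ω zero ∘ pullPath (tail ω)
  walkPath {zero}  ω = id
  walkPath {suc j} ω = walkPath (tail ω) ∘ ω zero

  -- The initial state is arbitrary because the induction absorbs the first round into it.
  run-pullStep : ∀ {O : Set} {j} (ω : Vector (Round enum) j) (x : V → O) →
    run enum (pullStep enum) x ω (fromℕ j) ≗ x ∘ pullPath ω
  run-pullStep {j = zero}  ω x u = refl
  run-pullStep {j = suc j} ω x u = run-pullStep (tail ω) (x ∘ ω zero) u

  run-walkStep : ∀ {j} (ω : Vector (Round enum) j) (x : V → V) →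
    run enum (walkStep enum) x ω (fromℕ j) ≗ walkPath ω ∘ x
  run-walkStep {zero}  ω x w = refl
  run-walkStep {suc j} ω x w = run-walkStep (tail ω) (ω zero ∘ x) w

  -- `pullPath` recurses on the first round, but a reversed walk starts with the last one, which
  -- therefore has to be split off as the innermost factor.
  pullPath-last : ∀ {j} (ω : Vector (Round enum) (suc j)) →
    pullPath ω ≗ pullPath (ω ∘ inject₁) ∘ ω (fromℕ j)
  pullPath-last {zero}  ω v = refl
  pullPath-last {suc j} ω v = cong (ω zero) (pullPath-last (tail ω) v)

  walkPath-opposite : ∀ {j} {ω ω′ : Vector (Round enum) j} →
    (∀ t → ω′ t ≗ ω (opposite t)) → walkPath ω′ ≗ pullPath ω
  walkPath-opposite {zero}                e v = refl
  walkPath-opposite {suc j} {ω} {ω′} e v = begin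
    -- `opposite (suc t)` computes to `inject₁ (opposite t)`, so `e ∘ suc` is the hypothesis for
    -- `ω ∘ inject₁`; likewise `opposite zero` is `fromℕ j`.
    walkPath (tail ω′) (ω′ zero v)           ≡⟨ walkPath-opposite (e ∘ suc) (ω′ zero v) ⟩
    pullPath (ω ∘ inject₁) (ω′ zero v)       ≡⟨ cong (pullPath (ω ∘ inject₁)) (e zero v) ⟩
    pullPath (ω ∘ inject₁) (ω (fromℕ j) v)   ≡⟨ pullPath-last ω v ⟨
    pullPath ω v                             ∎
    where open ≡-Reasoning

  Constant-cong : ∀ {A : Set} {x y : V → A} → x ≗ y → Constant enum x → Constant enum y
  Constant-cong x≗y c u v = subst₂ _≡_ (x≗y u) (x≗y v) (c u v)

  consensus⇔coalescence : ∀ {O : Set} → DecidableEquality O →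
    (ξ : V → O) → Injective _≡_ _≡_ ξ →
    ∀ {j} (ω ω′ : Vector (Round enum) j) → (∀ t → ω′ t ≗ ω (opposite t)) →
    FirstConstant≤ enum j (opinions enum ξ ω) ⇔ FirstConstant≤ enum j (positions enum ω′)
  consensus⇔coalescence _≟_ ξ ξ-injective {j} ω ω′ e =
    ⇔-trans (FirstConstant≤⇔final (pullStep enum) (λ f _ c u v → c (f u) (f v)) _≟_ ω ξ)
    (⇔-trans (mk⇔ coalesce agree)
    (⇔-sym (FirstConstant≤⇔final (walkStep enum) (λ f _ c u v → cong f (c u v))
      (inj⇒≟ (Inverse⇒Injection enum)) ω′ id)))
    where
    positions-final : positions enum ω′ (fromℕ j) ≗ pullPath ω
    positions-final w = trans (run-walkStep ω′ id w) (walkPath-opposite e w)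

    coalesce : Constant enum (opinions enum ξ ω (fromℕ j)) →
      Constant enum (positions enum ω′ (fromℕ j))
    -- Distinct initial opinions enter here: agreeing on an opinion forces a common origin under
    -- `pullPath ω`.
    coalesce c = Constant-cong (sym ∘ positions-final)
      λ u v → ξ-injective (Constant-cong (run-pullStep ω ξ) c u v)

    agree : Constant enum (positions enum ω′ (fromℕ j)) →
      Constant enum (opinions enum ξ ω (fromℕ j))
    agree c = Constant-cong (sym ∘ run-pullStep ω ξ)
      λ u v → cong ξ (Constant-cong positions-final c u v)

  -- Indices start at 0, so this swaps rounds 1, …, i; every t ≥ i is sent to 0.
  reverseRounds : {A : Set} → (ℕ → A) → ℕ → ℕ → A
  reverseRounds P i t = P (i ∸ suc t)

  weight-opposite : ∀ P {j} (ω ω′ : Vector (Round enum) j) → (∀ t → ω′ t ≗ ω (opposite t)) →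
    weight enum P ω ≈ weight enum (reverseRounds P j) ω′
  weight-opposite P {j} ω ω′ e = begin
    product roundWeight              ≈⟨ ΠR.sum-permute roundWeight reverse ⟩
    product (roundWeight ∘ opposite) ≡⟨ ΠR.sum-cong-≗ (λ t → ΠR.sum-cong-≗ (entry t ∘ from)) ⟩
    weight enum (reverseRounds P j) ω′ ∎
    where
    open SetoidReasoning setoid
    roundWeight : Fin j → ℝ
    roundWeight t = ∏ enum (λ u → P (toℕ t) u (ω t u))

    entry : ∀ t u → P (toℕ (opposite t)) u (ω (opposite t) u) ≡ reverseRounds P j (toℕ t) u (ω′ t u)
    -- `opposite-prop` gives `toℕ (opposite t)` as `j ∸ suc (toℕ t)`, the index that `reverseRounds`
    -- uses.
    entry t u = cong₂ (λ s v → P s u v) (opposite-prop t) (sym (e t u))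

  outcome-reverseDigits : ∀ j k t →
    outcome enum {j} (reverseDigits (n ^ n) j k) t ≗ outcome enum {j} k (opposite t)
  outcome-reverseDigits j k t u =
    cong (λ d → from (finToFun {n} {n} d (to u))) (finToFun-reverseDigits (n ^ n) j k t)

  -- Reversal permutes the outcomes, carries `E` to `F`, and preserves weights once the matrices are
  -- reversed too, so the two finite sums agree term by term after reindexing. The rounds are
  -- related pointwise, which avoids function extensionality.
  Pr-reverse : ∀ P j {E F : Vector (Round enum) j → Set}
    (E? : ∀ ω → Dec (E ω)) (F? : ∀ ω → Dec (F ω)) →
    (∀ ω ω′ → (∀ t → ω′ t ≗ ω (opposite t)) → E ω ⇔ F ω′) →
    Pr enum P j E? ≈ Pr enum (reverseRounds P j) j F?
  Pr-reverse P j E? F? E⇔F = begin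
    Pr enum P j E?                          ≈⟨ ΣR.sum-cong-≋ summand ⟩
    sum (f ∘ reverseDigits (n ^ n) j)       ≈⟨ ΣR.sum-permute f (digitReversal (n ^ n) j) ⟨
    Pr enum (reverseRounds P j) j F?        ∎
    where
    open SetoidReasoning setoid
    out : Fin ((n ^ n) ^ j) → Vector (Round enum) j
    out = outcome enum

    f : Fin ((n ^ n) ^ j) → ℝ
    f k = if does (F? (out k)) then weight enum (reverseRounds P j) (out k) else 0ℝ

    summand : ∀ k → (if does (E? (out k)) then weight enum P (out k) else 0ℝ) ≈
                    f (reverseDigits (n ^ n) j k)
    summand k
      -- After this both conditionals test the same Boolean; if it is `false`, both sides are `0ℝ`.
      rewrite does-⇔ (E⇔F (out k) (out (reverseDigits (n ^ n) j k)) (outcome-reverseDigits j k))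
                (E? (out k)) (F? (out (reverseDigits (n ^ n) j k)))
      with does (F? (out (reverseDigits (n ^ n) j k)))
    ... | true  = weight-opposite P (out k) (out (reverseDigits (n ^ n) j k)) (outcome-reverseDigits j k)
    ... | false = reflexive refl

proposition6p2 : ∀ {n : ℕ} {V : Set} (enum : V ↔ Fin n)
    (P : ℕ → Matrix V) → (∀ t → IsTransition enum (P t)) →
    {O : Set} (_≟_ : DecidableEquality O) (ξ : V → O) → Injective _≡_ _≡_ ξ →
    Σ[ Q ∈ (ℕ → ℕ → Matrix V) ]
    (∀ i t → IsTransition enum (Q i t)) ×
    (∀ j → Pr[τcons_⟨_,_⟩≤_] enum P _≟_ ξ j ≈ Pr[τcoal_≤_] enum (Q j) j) ×
    (∀ π → (∀ t → IsReversibleStationary enum π (P t)) →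
    ∀ i t → IsReversibleStationary enum π (Q i t))
proposition6p2 enum P P-transition _≟_ ξ ξ-injective =
  reverseRounds enum P ,
  -- Every matrix of every `Q i` is literally some `P s`, so stochasticity, and below reversibility
  -- with respect to the same `π`, are inherited.
  (λ i t → P-transition (i ∸ suc t)) ,
  (λ j → Pr-reverse enum P j
    (λ ω → firstConstant≤? enum _≟_ j (opinions enum ξ ω))
    (λ ω → firstConstant≤? enum (inj⇒≟ (Inverse⇒Injection enum)) j (positions enum ω))
    (consensus⇔coalescence enum _≟_ ξ ξ-injective)) ,
  λ π P-reversible i t → P-reversible (i ∸ suc t)
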